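{- Let $H$ be an even graph of order $n$. For any positive integer $m\geq 2$, $p(P_m\Box H)=\frac{n_o(P_m\Box H)}{2}$.
   Context: All graphs are finite, simple and undirected. An even graph is a graph in which every vertex has even degree. $P_m$ is the path on $m$ vertices. A path decomposition of a graph $G$ is a collection of edge-disjoint paths covering all edges of $G$; $p(G)$ denotes the minimum number of paths in a path decomposition of $G$. $n_o(G)$ denotes the number of vertices of odd degree in $G$. The Cartesian product $G\Box H$ has vertex set $V(G)\times V(H)$, with $(u_1,v_1)(u_2,v_2)$ an edge iff either $u_1u_2\in E(G)$ and $v_1=v_2$, or $v_1v_2\in E(H)$ and $u_1=u_2$. -}

module Defs where

open import Data.Bool using (Bool; true; false; _∧_; _∨_; if_then_else_; T)
open import Data.Bool.Properties using (∨-comm)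
open import Data.Nat using (ℕ; zero; suc; _+_; _≡ᵇ_; _≤_)
open import Data.Nat.DivMod using (_%_; _/_)
open import Data.Fin using (Fin; toℕ; remQuot)
open import Data.List using (List; []; _∷_; length; map; allFin; concatMap)
open import Data.Nat.ListAction using (sum)
open import Data.List.Relation.Unary.All using (All)
open import Data.List.Relation.Unary.Unique.Propositional using (Unique)
open import Data.Product using (_×_; _,_; Σ; ∃)
open import Relation.Binary.PropositionalEquality using (_≡_; refl; cong₂)

_=ᶠ_ : ∀ {n} → Fin n → Fin n → Bool
a =ᶠ b = toℕ a ≡ᵇ toℕ b

≡ᵇ-sym : ∀ x y → (x ≡ᵇ y) ≡ (y ≡ᵇ x)
≡ᵇ-sym zero zero = refl
≡ᵇ-sym zero (suc y) = refl
≡ᵇ-sym (suc x) zero = refl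
≡ᵇ-sym (suc x) (suc y) = ≡ᵇ-sym x y

≡ᵇ-refl : ∀ x → (x ≡ᵇ x) ≡ true
≡ᵇ-refl zero = refl
≡ᵇ-refl (suc x) = ≡ᵇ-refl x

suc≢ᵇ : ∀ x → (suc x ≡ᵇ x) ≡ false
suc≢ᵇ zero = refl
suc≢ᵇ (suc x) = suc≢ᵇ x

record Graph (n : ℕ) : Set where
  field
    adj   : Fin n → Fin n → Bool
    sym   : ∀ u v → adj u v ≡ adj v u
    irrfl : ∀ v → adj v v ≡ false
open Graph public

deg : ∀ {n} → Graph n → Fin n → ℕ
deg {n} G u = sum (map (λ v → if adj G u v then 1 else 0) (allFin n))

IsEvenGraph : ∀ {n} → Graph n → Set
IsEvenGraph G = ∀ v → deg G v % 2 ≡ 0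

nOdd : ∀ {n} → Graph n → ℕ
nOdd {n} G = sum (map (λ v → if deg G v % 2 ≡ᵇ 1 then 1 else 0) (allFin n))

pathGraph : (m : ℕ) → Graph m
pathGraph m = record
  { adj = λ i j → (suc (toℕ i) ≡ᵇ toℕ j) ∨ (suc (toℕ j) ≡ᵇ toℕ i)
  ; sym = λ i j → ∨-comm (suc (toℕ i) ≡ᵇ toℕ j) (suc (toℕ j) ≡ᵇ toℕ i)
  ; irrfl = λ i → pf i
  }
  where
  pf : (i : Fin m) → ((suc (toℕ i) ≡ᵇ toℕ i) ∨ (suc (toℕ i) ≡ᵇ toℕ i)) ≡ false
  pf i rewrite suc≢ᵇ (toℕ i) = refl

prodAdj : ∀ {m n} → Graph m → Graph n → Fin m → Fin n → Fin m → Fin n → Bool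
prodAdj G H i a j b = (adj G i j ∧ (a =ᶠ b)) ∨ ((i =ᶠ j) ∧ adj H a b)

_□_ : ∀ {m n} → Graph m → Graph n → Graph (m Data.Nat.* n)
_□_ {m} {n} G H = record
  { adj = λ x y → go (remQuot n x) (remQuot n y)
  ; sym = λ x y → gsym (remQuot n x) (remQuot n y)
  ; irrfl = λ x → girr (remQuot n x)
  }
  where
  go : Fin m × Fin n → Fin m × Fin n → Bool
  go (i , a) (j , b) = prodAdj G H i a j b
  gsym : ∀ p q → go p q ≡ go q p
  gsym (i , a) (j , b)
    rewrite sym G i j | sym H a b | ≡ᵇ-sym (toℕ a) (toℕ b) | ≡ᵇ-sym (toℕ i) (toℕ j) = refl
  girr : ∀ p → go p p ≡ false
  girr (i , a) rewrite irrfl G i | irrfl H a | ≡ᵇ-refl (toℕ i) = refl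

steps : ∀ {n} → List (Fin n) → List (Fin n × Fin n)
steps [] = []
steps (x ∷ []) = []
steps (x ∷ y ∷ xs) = (x , y) ∷ steps (y ∷ xs)

Walk : ∀ {n} → Graph n → List (Fin n) → Set
Walk G xs = All (λ { (a , b) → adj G a b ≡ true }) (steps xs)

IsPath : ∀ {n} → Graph n → List (Fin n) → Set
IsPath G xs = Unique xs × Walk G xs × (2 ≤ length xs)

edgeUses : ∀ {n} → List (List (Fin n)) → Fin n → Fin n → ℕ
edgeUses ps u v =
  sum (map (λ { (a , b) → if ((a =ᶠ u) ∧ (b =ᶠ v)) ∨ ((a =ᶠ v) ∧ (b =ᶠ u)) then 1 else 0 })
           (concatMap steps ps))

IsPathDecomposition : ∀ {n} → Graph n → List (List (Fin n)) → Set
IsPathDecomposition G ps =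
  All (IsPath G) ps × (∀ u v → adj G u v ≡ true → edgeUses ps u v ≡ 1)

PathNumberIs : ∀ {n} → Graph n → ℕ → Set
PathNumberIs G k =
  Σ (List (List _)) (λ ps → IsPathDecomposition G ps × length ps ≡ k)
  × (∀ ps → IsPathDecomposition G ps → k ≤ length ps)

{-# OPTIONS --safe #-}
module Submission where

-- Each layer is covered by n directed, possibly trivial, paths such that every vertex is the start of
-- exactly one of them and the end of exactly one. A path that ends at v in one layer is continued,
-- through the edge above v, by the path that starts at v in the next layer. The resulting n paths never
-- return to a layer, and all their ends are distinct: they start in the bottom layer and stop in the
-- top one. In any decomposition, a vertex has odd degree exactly when it is an end of an odd number of
-- paths; so there are 2n odd vertices, and no decomposition has fewer than n paths.
--
-- The cover of an even graph H is built by adding the edges one at a time to the trivial paths, keeping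
-- the starts fixed. Adding ab moves one end from b to a by a chain of rotations at a (Fan), which only
-- requires that all neighbours of a be ends. By parity, a vertex that is no longer an end still has an
-- unused edge, and this is the edge that is added next.

open import Defs hiding (sym)
open import Data.Bool using (Bool; T; true; false; _∧_; _∨_; if_then_else_)
open import Data.Bool.Properties using (∧-comm; ∧-conicalʳ; ∨-comm; ∧-zeroʳ; ∨-identityʳ)
open import Data.Empty using (⊥)
open import Data.Fin using (Fin; zero; suc; toℕ; splitAt; _↑ˡ_; _↑ʳ_; _≟_; _<?_)
open import Data.Fin.Properties using (toℕ-injective; <-cmp; splitAt-↑ˡ; splitAt-↑ʳ; join-splitAt; ↑ˡ-injective; ↑ʳ-injective)
open import Data.List using (List; []; _∷_; _++_; length; map; allFin; concatMap; zipWith)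
open import Data.List.Membership.Propositional using (_∈_; _∉_; find; lose)
open import Data.List.Membership.Propositional.Properties using (∈-allFin; ∈-∃++; ∈-map⁻; ∈-concatMap⁺; ∈-concatMap⁻)
open import Data.List.Membership.DecPropositional using (_∈?_)
open import Data.List.Properties using (map-++; map-cong; map-∘; map-id; length-map; length-++; ∷-injectiveˡ; ∷-injectiveʳ)
open import Data.List.Relation.Binary.Permutation.Propositional using (_↭_; ↭-refl; ↭-sym; ↭-trans; prep; swap; ↭-reflexive; ↭⇒↭ₛ; module PermutationReasoning)
open import Data.List.Relation.Binary.Permutation.Propositional.Properties as ↭ using (∈-resp-↭; All-resp-↭; ∷↭∷ʳ; shift; drop-∷; ↭-length)
import Data.List.Relation.Binary.Permutation.Setoid.Properties as ↭ₛ
open import Data.List.Relation.Unary.All as All using (All; []; _∷_)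
import Data.List.Relation.Unary.All.Properties as All
open import Data.List.Relation.Unary.AllPairs using ([]; _∷_)
open import Data.List.Relation.Unary.Any using (here; there)
open import Data.List.Relation.Unary.Unique.Propositional using (Unique)
open import Data.List.Relation.Unary.Unique.Propositional.Properties using (allFin⁺; Unique[x∷xs]⇒x∉xs)
import Data.List.Relation.Unary.Unique.Propositional.Properties as Unique
open import Data.Nat using (ℕ; zero; suc; _+_; _*_; _≤_; z≤n; s≤s; s≤s⁻¹; _≡ᵇ_; _/_; _%_)
open import Data.Nat.DivMod using (m*n/n≡m; /-monoˡ-≤; [m+kn]%n≡m%n)
open import Data.Nat.Properties hiding (_≟_; _<?_; <-cmp)
open import Data.Nat.ListAction using (sum)
open import Data.Nat.ListAction.Properties using (sum-++; sum-↭)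
open import Algebra.Properties.CommutativeSemigroup +-commutativeSemigroup using (interchange; x∙yz≈y∙xz)
open import Data.Nat.Tactic.RingSolver using (solve-∀)
open import Data.Product using (_×_; _,_; ∃; ∃₂; proj₁; proj₂)
open import Data.Sum using (_⊎_; inj₁; inj₂)
open import Function using (_∘_)
open import Relation.Binary using (tri<; tri≈; tri>)
open import Relation.Nullary using (yes; no; contradiction; does)
open import Relation.Nullary.Decidable using (dec-true; dec-false)
open import Relation.Binary.PropositionalEquality

private variable
  X Y : Set
  n : ℕ

-- Finite sums over lists.

∑ : List X → (X → ℕ) → ℕ
∑ xs f = sum (map f xs)

∑-cong-∈ : (xs : List X) {f g : X → ℕ} → (∀ {x} → x ∈ xs → f x ≡ g x) → ∑ xs f ≡ ∑ xs g
∑-cong-∈ []       eq = refl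
∑-cong-∈ (x ∷ xs) eq = cong₂ _+_ (eq (here refl)) (∑-cong-∈ xs (eq ∘ there))

∑-cong : (xs : List X) {f g : X → ℕ} → (∀ x → f x ≡ g x) → ∑ xs f ≡ ∑ xs g
∑-cong xs eq = ∑-cong-∈ xs (λ {x} _ → eq x)

∑-mono : (xs : List X) {f g : X → ℕ} → (∀ x → f x ≤ g x) → ∑ xs f ≤ ∑ xs g
∑-mono []       le = z≤n
∑-mono (x ∷ xs) le = +-mono-≤ (le x) (∑-mono xs le)

∑-++ : (xs ys : List X) (f : X → ℕ) → ∑ (xs ++ ys) f ≡ ∑ xs f + ∑ ys f
∑-++ xs ys f = trans (cong sum (map-++ f xs ys)) (sum-++ (map f xs) (map f ys))

∑-map : (g : X → Y) (xs : List X) (f : Y → ℕ) → ∑ (map g xs) f ≡ ∑ xs (f ∘ g)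
∑-map g []       f = refl
∑-map g (x ∷ xs) f = cong (f (g x) +_) (∑-map g xs f)

∑-concatMap : (g : X → List Y) (xs : List X) (f : Y → ℕ) →
              ∑ (concatMap g xs) f ≡ ∑ xs (λ x → ∑ (g x) f)
∑-concatMap g []       f = refl
∑-concatMap g (x ∷ xs) f =
  trans (∑-++ (g x) (concatMap g xs) f) (cong (∑ (g x) f +_) (∑-concatMap g xs f))

∑-↭ : {xs ys : List X} (f : X → ℕ) → xs ↭ ys → ∑ xs f ≡ ∑ ys f
∑-↭ f p = sum-↭ (↭.map⁺ f p)

∑-zero : (xs : List X) → ∑ xs (λ _ → 0) ≡ 0
∑-zero []       = refl
∑-zero (x ∷ xs) = ∑-zero xs

∑-const : (xs : List X) (k : ℕ) → ∑ xs (λ _ → k) ≡ length xs * k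
∑-const []       k = refl
∑-const (x ∷ xs) k = cong (k +_) (∑-const xs k)

∑-+ : (xs : List X) (f g : X → ℕ) → ∑ xs (λ x → f x + g x) ≡ ∑ xs f + ∑ xs g
∑-+ []       f g = refl
∑-+ (x ∷ xs) f g = trans (cong (f x + g x +_) (∑-+ xs f g)) (interchange (f x) (g x) (∑ xs f) (∑ xs g))

∑-*ˡ : (xs : List X) (k : ℕ) (f : X → ℕ) → ∑ xs (λ x → k * f x) ≡ k * ∑ xs f
∑-*ˡ []       k f = sym (*-zeroʳ k)
∑-*ˡ (x ∷ xs) k f = trans (cong (k * f x +_) (∑-*ˡ xs k f)) (sym (*-distribˡ-+ k (f x) _))

∑-swap : (xs : List X) (ys : List Y) (f : X → Y → ℕ) →
         ∑ xs (λ x → ∑ ys (f x)) ≡ ∑ ys (λ y → ∑ xs (λ x → f x y))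
∑-swap []       ys f = sym (∑-zero ys)
∑-swap (x ∷ xs) ys f =
  trans (cong (∑ ys (f x) +_) (∑-swap xs ys f)) (sym (∑-+ ys (f x) (λ y → ∑ xs (λ x → f x y))))

∈⇒≤∑ : {xs : List X} {x : X} (f : X → ℕ) → x ∈ xs → f x ≤ ∑ xs f
∈⇒≤∑ f (here refl) = m≤m+n _ _
∈⇒≤∑ {xs = y ∷ _} f (there x∈) = ≤-trans (∈⇒≤∑ f x∈) (m≤n+m _ (f y))

-- Indicators and the Kronecker delta.

𝟙 : Bool → ℕ
𝟙 b = if b then 1 else 0

𝟙≤1 : ∀ b → 𝟙 b ≤ 1
𝟙≤1 false = z≤n
𝟙≤1 true  = ≤-refl

𝟙-positive : ∀ b → 1 ≤ 𝟙 b → b ≡ true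
𝟙-positive true _ = refl

=ᶠ-refl : (x : Fin n) → (x =ᶠ x) ≡ true
=ᶠ-refl x = ≡ᵇ-refl (toℕ x)

=ᶠ-≢ : {x y : Fin n} → x ≢ y → (x =ᶠ y) ≡ false
=ᶠ-≢ {x = x} {y} x≢y with x =ᶠ y in eq
... | false = refl
... | true  = contradiction (toℕ-injective (≡ᵇ⇒≡ (toℕ x) (toℕ y) (subst T (sym eq) _))) x≢y

=ᶠ-injective : ∀ {m} {f : Fin m → Fin n} → (∀ {x y} → f x ≡ f y → x ≡ y) →
               ∀ x y → (f x =ᶠ f y) ≡ (x =ᶠ y)
=ᶠ-injective {f = f} inj x y with x ≟ y
... | yes refl = trans (=ᶠ-refl (f x)) (sym (=ᶠ-refl x))
... | no  x≢y  = trans (=ᶠ-≢ (x≢y ∘ inj)) (sym (=ᶠ-≢ x≢y))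

δ : Fin n → Fin n → ℕ
δ x y = 𝟙 (x =ᶠ y)

δ-refl : (x : Fin n) → δ x x ≡ 1
δ-refl x = cong 𝟙 (=ᶠ-refl x)

δ-≢ : {x y : Fin n} → x ≢ y → δ x y ≡ 0
δ-≢ x≢y = cong 𝟙 (=ᶠ-≢ x≢y)

∑-δ-∉ : (xs : List (Fin n)) {v : Fin n} (f : Fin n → ℕ) → v ∉ xs → ∑ xs (λ x → δ x v * f x) ≡ 0
∑-δ-∉ []       f v∉ = refl
∑-δ-∉ (x ∷ xs) f v∉ =
  cong₂ _+_ (cong (_* f x) (δ-≢ (λ x≡v → v∉ (here (sym x≡v))))) (∑-δ-∉ xs f (v∉ ∘ there))

∑-δ-unique : {xs : List (Fin n)} {v : Fin n} (f : Fin n → ℕ) → Unique xs → v ∈ xs →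
             ∑ xs (λ x → δ x v * f x) ≡ f v
∑-δ-unique {xs = x ∷ xs} f uq (here refl)
  rewrite δ-refl x | ∑-δ-∉ xs f (Unique[x∷xs]⇒x∉xs uq) =
  trans (+-identityʳ _) (+-identityʳ _)
∑-δ-unique {xs = x ∷ xs} {v} f uq@(_ ∷ uq′) (there v∈)
  rewrite δ-≢ {x = x} {v} (λ { refl → Unique[x∷xs]⇒x∉xs uq v∈ }) = ∑-δ-unique f uq′ v∈

∑-δ : (v : Fin n) (f : Fin n → ℕ) → ∑ (allFin n) (λ x → δ x v * f x) ≡ f v
∑-δ v f = ∑-δ-unique f (allFin⁺ _) (∈-allFin v)

δ-sym : (x y : Fin n) → δ x y ≡ δ y x
δ-sym x y = cong 𝟙 (≡ᵇ-sym (toℕ x) (toℕ y))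

∑-δ*1 : (xs : List (Fin n)) (v : Fin n) → ∑ xs (λ x → δ x v) ≡ ∑ xs (λ x → δ x v * 1)
∑-δ*1 xs v = ∑-cong xs (λ x → sym (*-identityʳ (δ x v)))

∑-δ₁ : (v : Fin n) → ∑ (allFin n) (λ x → δ x v) ≡ 1
∑-δ₁ {n} v = trans (∑-δ*1 (allFin n) v) (∑-δ v (λ _ → 1))

∑-δʳ : (v : Fin n) → ∑ (allFin n) (δ v) ≡ 1
∑-δʳ {n} v = trans (∑-cong (allFin n) (δ-sym v)) (∑-δ₁ v)

∑-δ≤1 : {xs : List (Fin n)} (v : Fin n) → Unique xs → ∑ xs (λ x → δ x v) ≤ 1
∑-δ≤1 {xs = []}     v uq = z≤n
∑-δ≤1 {xs = x ∷ xs} v uq@(_ ∷ uq′) with x ≟ v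
... | no  x≢v  rewrite δ-≢ x≢v = ∑-δ≤1 v uq′
... | yes refl rewrite δ-refl x | ∑-δ*1 xs x | ∑-δ-∉ xs (λ _ → 1) (Unique[x∷xs]⇒x∉xs uq) = ≤-refl

-- Edge lists, multiplicities and degrees.

Edge : ℕ → Set
Edge n = Fin n × Fin n

-- The Boolean is the one inside `edgeUses`, so that `edgeUses` and `mult` agree summand by summand.
joins : Edge n → Fin n → Fin n → ℕ
joins (x , y) u v = 𝟙 (((x =ᶠ u) ∧ (y =ᶠ v)) ∨ ((x =ᶠ v) ∧ (y =ᶠ u)))

joins-self : (x y : Fin n) → joins (x , y) x y ≡ 1
joins-self x y rewrite =ᶠ-refl x | =ᶠ-refl y = refl

joins-flip : (x y u v : Fin n) → joins (x , y) u v ≡ joins (y , x) u v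
joins-flip x y u v = cong 𝟙 (trans (∨-comm ((x =ᶠ u) ∧ (y =ᶠ v)) _)
  (cong₂ _∨_ (∧-comm (x =ᶠ v) _) (∧-comm (x =ᶠ u) _)))

-- Distinct ends make the two orientations mutually exclusive, so the disjunction turns into a sum.
joins-δ : {x y : Fin n} → x ≢ y → ∀ u v → joins (x , y) u v ≡ δ x u * δ y v + δ y u * δ x v
joins-δ {x = x} {y} x≢y u v = lemma (x =ᶠ u) (y =ᶠ v) (x =ᶠ v) (y =ᶠ u) exclusive
  where
  lemma : ∀ a b c d → a ∧ d ≡ false →
          𝟙 ((a ∧ b) ∨ (c ∧ d)) ≡ 𝟙 a * 𝟙 b + 𝟙 d * 𝟙 c
  lemma false b false false _ = refl
  lemma false b false true  _ = refl
  lemma false b true  false _ = refl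
  lemma false b true  true  _ = refl
  lemma true false false false _ = refl
  lemma true false true  false _ = refl
  lemma true true  false false _ = refl
  lemma true true  true  false _ = refl
  exclusive : (x =ᶠ u) ∧ (y =ᶠ u) ≡ false
  exclusive with x ≟ u
  ... | no  x≢u  rewrite =ᶠ-≢ x≢u = refl
  ... | yes refl rewrite =ᶠ-refl x = =ᶠ-≢ (x≢y ∘ sym)

mult : List (Edge n) → Fin n → Fin n → ℕ
mult es u v = ∑ es (λ e → joins e u v)

incidences : List (Edge n) → Fin n → ℕ
incidences es v = ∑ es (λ (x , y) → δ x v + δ y v)

-- Non-edges must have multiplicity zero, so this also forces every listed pair to be an edge.
Covers : List (Edge n) → Graph n → Set
Covers es G = ∀ u v → mult es u v ≡ 𝟙 (adj G u v)

module _ (G : Graph n) (es : List (Edge n)) (cov : Covers es G) where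

  covers⇒adj : ∀ {x y} → (x , y) ∈ es → adj G x y ≡ true
  covers⇒adj {x} {y} e∈ = 𝟙-positive _ (begin
    1                 ≡⟨ joins-self x y ⟨
    joins (x , y) x y ≤⟨ ∈⇒≤∑ (λ e → joins e x y) e∈ ⟩
    mult es x y       ≡⟨ cov x y ⟩
    𝟙 (adj G x y)     ∎)
    where open ≤-Reasoning

  covers⇒≢ : ∀ {x y} → (x , y) ∈ es → x ≢ y
  covers⇒≢ {x} e∈ refl with () ← trans (sym (irrfl G x)) (covers⇒adj e∈)

  -- Double counting: after exchanging the sums over neighbours and over listed edges, each edge
  -- contributes one for each of its ends equal to `v`.
  deg≡incidences : ∀ v → deg G v ≡ incidences es v
  deg≡incidences v = begin
    ∑ (allFin n) (λ u → 𝟙 (adj G v u))             ≡⟨ ∑-cong (allFin n) (cov v) ⟨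
    ∑ (allFin n) (λ u → mult es v u)               ≡⟨ ∑-swap (allFin n) es (λ u e → joins e v u) ⟩
    ∑ es (λ e → ∑ (allFin n) (λ u → joins e v u))  ≡⟨ ∑-cong-∈ es (λ e∈ → at (covers⇒≢ e∈)) ⟩
    incidences es v                                ∎
    where
    open ≡-Reasoning
    at : ∀ {x y} → x ≢ y → ∑ (allFin n) (λ u → joins (x , y) v u) ≡ δ x v + δ y v
    at {x} {y} x≢y = begin
      ∑ (allFin n) (λ u → joins (x , y) v u)
        ≡⟨ ∑-cong (allFin n) (joins-δ x≢y v) ⟩
      ∑ (allFin n) (λ u → δ x v * δ y u + δ y v * δ x u)
        ≡⟨ ∑-+ (allFin n) (λ u → δ x v * δ y u) (λ u → δ y v * δ x u) ⟩
      ∑ (allFin n) (λ u → δ x v * δ y u) + ∑ (allFin n) (λ u → δ y v * δ x u)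
        ≡⟨ cong₂ _+_ (one x y) (one y x) ⟩
      δ x v + δ y v ∎
      where
      one : ∀ x y → ∑ (allFin n) (λ u → δ x v * δ y u) ≡ δ x v
      one x y = trans (∑-*ˡ (allFin n) (δ x v) (δ y)) (trans (cong (δ x v *_) (∑-δʳ y)) (*-identityʳ _))

-- Trails and their terminals.

-- A nonempty vertex list, so that start and end are total. A single vertex is a trail and counts as
-- two coinciding terminals.
Trail : ℕ → Set
Trail n = Fin n × List (Fin n)

start : Trail n → Fin n
start = proj₁

lastFrom : Fin n → List (Fin n) → Fin n
lastFrom x []       = x
lastFrom x (y ∷ ys) = lastFrom y ys

end : Trail n → Fin n
end (x , xs) = lastFrom x xs

verts : Trail n → List (Fin n)
verts (x , xs) = x ∷ xs

edges : Trail n → List (Edge n)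
edges p = steps (verts p)

allEdges : List (Trail n) → List (Edge n)
allEdges = concatMap edges

Simple : Trail n → Set
Simple p = Unique (verts p)

terminals : List (Trail n) → List (Fin n)
terminals U = map start U ++ map end U

endCount : List (Trail n) → Fin n → ℕ
endCount U v = ∑ (terminals U) (λ x → δ x v)

-- Every visit to `v` has an edge on either side, except that the start lacks the edge before it and
-- the end the edge after it; the two deltas make up for these.
trail-incidences : (x : Fin n) (xs : List (Fin n)) (v : Fin n) →
  incidences (steps (x ∷ xs)) v + (δ x v + δ (lastFrom x xs) v) ≡ 2 * ∑ (x ∷ xs) (λ z → δ z v)
trail-incidences x [] v = lemma (δ x v)
  where
  lemma : ∀ a → a + a ≡ 2 * (a + 0)
  lemma = solve-∀
trail-incidences x (y ∷ ys) v =
  lemma (δ x v) (δ y v) (incidences (steps (y ∷ ys)) v) _ _ (trail-incidences y ys v)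
  where
  regroup : ∀ a b c d → a + b + c + (a + d) ≡ 2 * a + (c + (b + d))
  regroup = solve-∀
  lemma : ∀ a b c d o → c + (b + d) ≡ 2 * o → a + b + c + (a + d) ≡ 2 * (a + o)
  lemma a b c d o eq =
    trans (regroup a b c d) (trans (cong (2 * a +_) eq) (sym (*-distribˡ-+ 2 a o)))

incidences-++ : (es fs : List (Edge n)) (v : Fin n) →
  incidences (es ++ fs) v ≡ incidences es v + incidences fs v
incidences-++ es fs v = ∑-++ es fs _

endCount-split : (U : List (Trail n)) (v : Fin n) →
  endCount U v ≡ ∑ U (λ p → δ (start p) v + δ (end p) v)
endCount-split U v = begin
  ∑ (terminals U) (λ x → δ x v)
    ≡⟨ ∑-++ (map start U) (map end U) _ ⟩
  ∑ (map start U) (λ x → δ x v) + ∑ (map end U) (λ x → δ x v)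
    ≡⟨ cong₂ _+_ (∑-map start U _) (∑-map end U _) ⟩
  ∑ U (λ p → δ (start p) v) + ∑ U (λ p → δ (end p) v)
    ≡⟨ ∑-+ U _ _ ⟨
  ∑ U (λ p → δ (start p) v + δ (end p) v) ∎
  where open ≡-Reasoning

trails-incidences : (U : List (Trail n)) (v : Fin n) →
  ∃ λ k → incidences (allEdges U) v + endCount U v ≡ k * 2
trails-incidences U v = ∑ U (λ p → ∑ (verts p) (λ x → δ x v)) , (begin
  incidences (allEdges U) v + endCount U v
    ≡⟨ cong₂ _+_ (∑-concatMap edges U _) (endCount-split U v) ⟩
  ∑ U (λ p → incidences (edges p) v) + ∑ U (λ p → δ (start p) v + δ (end p) v)
    ≡⟨ ∑-+ U _ _ ⟨
  ∑ U (λ p → incidences (edges p) v + (δ (start p) v + δ (end p) v))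
    ≡⟨ ∑-cong U (λ (x , xs) → trail-incidences x xs v) ⟩
  ∑ U (λ p → 2 * ∑ (verts p) (λ x → δ x v))
    ≡⟨ ∑-*ˡ U 2 _ ⟩
  2 * ∑ U (λ p → ∑ (verts p) (λ x → δ x v))
    ≡⟨ *-comm 2 (∑ U (λ p → ∑ (verts p) (λ x → δ x v))) ⟩
  ∑ U (λ p → ∑ (verts p) (λ x → δ x v)) * 2 ∎)
  where open ≡-Reasoning

∑-endCount : (U : List (Trail n)) → ∑ (allFin n) (endCount U) ≡ length U * 2
∑-endCount {n} U = begin
  ∑ (allFin n) (endCount U)
    ≡⟨ ∑-cong (allFin n) (endCount-split U) ⟩
  ∑ (allFin n) (λ v → ∑ U (λ p → δ (start p) v + δ (end p) v))
    ≡⟨ ∑-swap (allFin n) U _ ⟩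
  ∑ U (λ p → ∑ (allFin n) (λ v → δ (start p) v + δ (end p) v))
    ≡⟨ ∑-cong U (λ p → trans (∑-+ (allFin n) _ _) (cong₂ _+_ (∑-δʳ (start p)) (∑-δʳ (end p)))) ⟩
  ∑ U (λ _ → 2)
    ≡⟨ ∑-const U 2 ⟩
  length U * 2 ∎
  where open ≡-Reasoning

-- Parity and the number of odd vertices.

oddBit : ℕ → ℕ
oddBit d = 𝟙 (d % 2 ≡ᵇ 1)

oddBit-+2 : ∀ d → oddBit (2 + d) ≡ oddBit d
oddBit-+2 d = cong (λ r → 𝟙 (r ≡ᵇ 1))
  (trans (cong (_% 2) (+-comm 2 d)) ([m+kn]%n≡m%n d 1 2))

oddBit-≤ : ∀ d → oddBit d ≤ d
oddBit-≤ zero          = z≤n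
oddBit-≤ (suc zero)    = ≤-refl
oddBit-≤ (suc (suc d)) = ≤-trans (≤-reflexive (oddBit-+2 d))
  (≤-trans (oddBit-≤ d) (≤-trans (n≤1+n d) (n≤1+n (suc d))))

oddBit-≤1 : ∀ {d} → d ≤ 1 → oddBit d ≡ d
oddBit-≤1 z≤n       = refl
oddBit-≤1 (s≤s z≤n) = refl

oddBit-even-sum : ∀ d e k → d + e ≡ k * 2 → oddBit d ≡ oddBit e
oddBit-even-sum zero          e k       refl = sym (even k)
  where
  even : ∀ k → oddBit (k * 2) ≡ 0
  even zero    = refl
  even (suc k) = trans (oddBit-+2 (k * 2)) (even k)
oddBit-even-sum (suc zero)    e (suc k) eq = sym (trans (cong oddBit (suc-injective eq)) (odd k))
  where
  odd : ∀ k → oddBit (suc (k * 2)) ≡ 1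
  odd zero    = refl
  odd (suc k) = trans (oddBit-+2 (suc (k * 2))) (odd k)
oddBit-even-sum (suc (suc d)) e (suc k) eq =
  trans (oddBit-+2 d) (oddBit-even-sum d e k (suc-injective (suc-injective eq)))

-- Interior vertices of a trail contribute two to their degree, so only trail ends affect parity.
module _ (G : Graph n) (U : List (Trail n)) (cov : Covers (allEdges U) G) where

  oddBit-deg : ∀ v → oddBit (deg G v) ≡ oddBit (endCount U v)
  oddBit-deg v =
    let k , eq = trails-incidences U v
    in oddBit-even-sum (deg G v) _ k (trans (cong (_+ endCount U v) (deg≡incidences G (allEdges U) cov v)) eq)

  nOdd≤ : nOdd G ≤ length U * 2
  nOdd≤ = begin
    ∑ (allFin n) (λ v → oddBit (deg G v))      ≡⟨ ∑-cong (allFin n) oddBit-deg ⟩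
    ∑ (allFin n) (λ v → oddBit (endCount U v)) ≤⟨ ∑-mono (allFin n) (λ v → oddBit-≤ (endCount U v)) ⟩
    ∑ (allFin n) (endCount U)                  ≡⟨ ∑-endCount U ⟩
    length U * 2                               ∎
    where open ≤-Reasoning

  -- Distinct terminals keep each end count at most one, where a number equals its own parity bit;
  -- the estimate for `nOdd≤` becomes an equality.
  nOdd≡ : Unique (terminals U) → nOdd G ≡ length U * 2
  nOdd≡ uq = begin
    ∑ (allFin n) (λ v → oddBit (deg G v))
      ≡⟨ ∑-cong (allFin n) (λ v → trans (oddBit-deg v) (oddBit-≤1 (∑-δ≤1 v uq))) ⟩
    ∑ (allFin n) (endCount U)  ≡⟨ ∑-endCount U ⟩
    length U * 2               ∎
    where open ≡-Reasoning

-- Path decompositions as lists of trails.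

edgeUses≡mult : (U : List (Trail n)) (u v : Fin n) →
  edgeUses (map verts U) u v ≡ mult (allEdges U) u v
edgeUses≡mult U u v = trans (∑-cong (concatMap steps (map verts U)) (λ _ → refl))
  (cong (λ es → mult es u v) (concatMap-verts U))
  where
  concatMap-verts : (U : List (Trail n)) → concatMap steps (map verts U) ≡ allEdges U
  concatMap-verts []      = refl
  concatMap-verts (p ∷ U) = cong (edges p ++_) (concatMap-verts U)

-- A path has at least two vertices, so the empty list, which is no trail, cannot occur.
trailsOf : ∀ {G : Graph n} {ps} → All (IsPath G) ps → ∃ λ U → map verts U ≡ ps
trailsOf [] = [] , refl
trailsOf {G = G} {ps = (x ∷ xs) ∷ _} (_ ∷ paths) =
  let U , eq = trailsOf {G = G} paths in (x , xs) ∷ U , cong ((x ∷ xs) ∷_) eq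
trailsOf {ps = [] ∷ _} ((_ , _ , ()) ∷ _)

-- Reversal and rotation of trails.

Unique-resp-↭ : {xs ys : List X} → xs ↭ ys → Unique xs → Unique ys
Unique-resp-↭ p = ↭ₛ.Unique-resp-↭ (setoid _) (↭⇒↭ₛ p)

∈⇒↭∷ : {x : X} {xs : List X} → x ∈ xs → ∃ λ ys → xs ↭ x ∷ ys
∈⇒↭∷ x∈ with ys , zs , refl ← ∈-∃++ x∈ = ys ++ zs , shift _ ys zs

lastFrom-++ : (x : Fin n) (xs : List (Fin n)) (y : Fin n) (ys : List (Fin n)) →
  lastFrom x (xs ++ y ∷ ys) ≡ lastFrom y ys
lastFrom-++ x []       y ys = refl
lastFrom-++ x (z ∷ zs) y ys = lastFrom-++ z zs y ys

mult-++ : (x : Fin n) (xs : List (Fin n)) (y : Fin n) (ys : List (Fin n)) (u v : Fin n) →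
  mult (steps (x ∷ xs ++ y ∷ ys)) u v ≡
  mult (steps (x ∷ xs)) u v + joins (lastFrom x xs , y) u v + mult (steps (y ∷ ys)) u v
mult-++ x []       y ys u v = refl
mult-++ x (z ∷ zs) y ys u v = trans (cong (joins (x , z) u v +_) (mult-++ z zs y ys u v))
  (lemma (joins (x , z) u v) (mult (steps (z ∷ zs)) u v) (joins (lastFrom z zs , y) u v) _)
  where
  lemma : ∀ a b c d → a + (b + c + d) ≡ a + b + c + d
  lemma = solve-∀

mult-∷ʳ : (x : Fin n) (xs : List (Fin n)) (a u v : Fin n) →
  mult (steps (x ∷ xs ++ a ∷ [])) u v ≡ joins (a , lastFrom x xs) u v + mult (steps (x ∷ xs)) u v
mult-∷ʳ x xs a u v = trans (mult-++ x xs a [] u v) (trans (+-identityʳ _)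
  (trans (+-comm (mult (steps (x ∷ xs)) u v) _) (cong (_+ _) (joins-flip (lastFrom x xs) a u v))))

-- Rotation traverses the final segment of a trail backwards. Only what this needs is recorded: the
-- vertices, the two ends and the edge multiplicities.
reverse-trail : (x : Fin n) (xs : List (Fin n)) → ∃ λ zs →
  (lastFrom x xs ∷ zs ↭ x ∷ xs) × (lastFrom (lastFrom x xs) zs ≡ x) ×
  (∀ u v → mult (steps (lastFrom x xs ∷ zs)) u v ≡ mult (steps (x ∷ xs)) u v)
reverse-trail x [] = [] , ↭-refl , refl , λ _ _ → refl
reverse-trail x (y ∷ ys) with zs , perm , last , eq ← reverse-trail y ys =
  zs ++ x ∷ [] ,
  ↭-trans (↭-sym (∷↭∷ʳ x (lastFrom y ys ∷ zs))) (prep x perm) ,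
  lastFrom-++ (lastFrom y ys) zs x [] ,
  λ u v → trans (mult-∷ʳ (lastFrom y ys) zs x u v)
                (cong₂ _+_ (cong (λ z → joins (x , z) u v) last) (eq u v))

-- A trail … a y … b, together with the edge ab, is rerouted as … a b … y, which frees the edge ay.
rotate : (a x : Fin n) (xs : List (Fin n)) → a ∈ x ∷ xs → a ≢ lastFrom x xs →
  ∃₂ λ zs (r : Fin n → Fin n → ℕ) → (x ∷ zs ↭ x ∷ xs) ×
  (∀ u v → mult (steps (x ∷ zs)) u v ≡ joins (a , lastFrom x xs) u v + r u v) ×
  (∀ u v → mult (steps (x ∷ xs)) u v ≡ joins (a , lastFrom x zs) u v + r u v)
rotate a x []       (here refl) a≢b = contradiction refl a≢b
-- The trail begins at the rotation point, so everything after it is reversed; `r` counts the edges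
-- of the reversed segment, which both trails share.
rotate a x (y ∷ ys) (here refl) a≢b with zs , perm , last , eq ← reverse-trail y ys =
  lastFrom y ys ∷ zs , mult (steps (y ∷ ys)) , prep x perm ,
  (λ u v → cong (joins (x , lastFrom y ys) u v +_) (eq u v)) ,
  (λ u v → cong (λ z → joins (x , z) u v + mult (steps (y ∷ ys)) u v) (sym last))
rotate a x (y ∷ ys) (there a∈)  a≢b with zs , r , perm , new , old ← rotate a y ys a∈ a≢b =
  y ∷ zs , (λ u v → joins (x , y) u v + r u v) , prep x perm ,
  (λ u v → trans (cong (joins (x , y) u v +_) (new u v))
    (x∙yz≈y∙xz (joins (x , y) u v) (joins (a , lastFrom y ys) u v) _)) ,
  (λ u v → trans (cong (joins (x , y) u v +_) (old u v))
    (x∙yz≈y∙xz (joins (x , y) u v) (joins (a , lastFrom y zs) u v) _))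

-- Adding one edge to a system of trails.

trailMult : List (Trail n) → Fin n → Fin n → ℕ
trailMult U u v = ∑ U (λ p → mult (edges p) u v)

trailMult≡mult : (U : List (Trail n)) (u v : Fin n) → trailMult U u v ≡ mult (allEdges U) u v
trailMult≡mult U u v = sym (∑-concatMap edges U (λ e → joins e u v))

-- Placing `b` on one side and `a` on the other says, without multiset subtraction, that one end `b`
-- has been exchanged for an end `a`.
Extension : List (Trail n) → Fin n → Fin n → Set
Extension U a b = ∃ λ U′ → All Simple U′ × (map start U′ ↭ map start U) ×
  (b ∷ map end U′ ↭ a ∷ map end U) ×
  (∀ u v → trailMult U′ u v ≡ joins (a , b) u v + trailMult U u v)

-- Fan's chain of rotations. If a trail ending at b avoids a, append a to it; otherwise rotating it
-- at a frees an edge ay, which is then added to the other trails. The neighbourhood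
-- condition on a is inherited by those trails, since ab is now used up and only b lost an end.
extend : ∀ k (U : List (Trail n)) → length U ≡ k → All Simple U → (a b : Fin n) →
  (∀ v → joins (a , b) a v + trailMult U a v ≤ 1) →
  joins (a , b) a a + trailMult U a a ≡ 0 →
  (∀ v → 1 ≤ joins (a , b) a v + trailMult U a v → v ∈ map end U) →
  Extension U a b
extend zero [] len simple a b ≤1 ≡0 hit
  with () ← hit b (≤-trans (≤-reflexive (sym (joins-self a b))) (m≤m+n _ _))
extend {n} (suc k) U len simple a b ≤1 ≡0 hit
  -- The pending edge makes `b` itself a neighbour of `a`, so some trail ends at `b`.
  with ∈-map⁻ end (hit b (≤-trans (≤-reflexive (sym (joins-self a b))) (m≤m+n _ _)))
... | (x , xs) , p∈U , refl
  with W , perm ← ∈⇒↭∷ p∈U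
  with uniq ∷ simpleW ← All-resp-↭ perm simple
  with _∈?_ _≟_ a (x ∷ xs)
... | no a∉ =
  (x , xs ++ a ∷ []) ∷ W ,
  Unique-resp-↭ (∷↭∷ʳ a (x ∷ xs)) (All.¬Any⇒All¬ (x ∷ xs) a∉ ∷ uniq) ∷ simpleW ,
  ↭-sym (↭.map⁺ start perm) ,
  (begin
    lastFrom x xs ∷ lastFrom x (xs ++ a ∷ []) ∷ map end W
      ≡⟨ cong (λ z → lastFrom x xs ∷ z ∷ map end W) (lastFrom-++ x xs a []) ⟩
    lastFrom x xs ∷ a ∷ map end W
      ↭⟨ swap _ _ ↭-refl ⟩
    a ∷ map end ((x , xs) ∷ W)
      ↭⟨ prep a (↭.map⁺ end perm) ⟨
    a ∷ map end U ∎) ,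
  λ u v → trans (cong (_+ trailMult W u v) (mult-∷ʳ x xs a u v))
    (trans (+-assoc (joins (a , lastFrom x xs) u v) _ _)
           (cong (joins (a , lastFrom x xs) u v +_) (sym (∑-↭ _ perm))))
  where open PermutationReasoning hiding (start)
... | yes a∈ =
  -- The rotated trail now ends at `y`, the very end that the other trails exchange for `a`; in
  -- total only `b` has been replaced by `a`.
  (x , zs) ∷ W′ ,
  Unique-resp-↭ (↭-sym rotPerm) uniq ∷ simpleW′ ,
  ↭-trans (prep x startsW′) (↭-sym (↭.map⁺ start perm)) ,
  (begin
    b ∷ y ∷ map end W′          ↭⟨ prep b endsW′ ⟩
    b ∷ a ∷ map end W           ↭⟨ swap b a ↭-refl ⟩
    a ∷ map end ((x , xs) ∷ W)  ↭⟨ prep a (↭.map⁺ end perm) ⟨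
    a ∷ map end U               ∎) ,
  λ u v → trans (cong₂ _+_ (new u v) (multW′ u v))
    (trans (move (joins (a , b) u v) (r u v) (joins (a , y) u v) (trailMult W u v))
           (sym (cong (joins (a , b) u v +_) (split u v))))
  where
  open PermutationReasoning hiding (start)
  -- A loop would be counted at the pair `a`, `a`, where the count is zero.
  a≢b : a ≢ b
  a≢b refl with () ← trans (sym (joins-self a a)) (m+n≡0⇒m≡0 _ ≡0)
  rotation = rotate a x xs a∈ a≢b
  zs = proj₁ rotation
  r = proj₁ (proj₂ rotation)
  rotPerm = proj₁ (proj₂ (proj₂ rotation))
  new = proj₁ (proj₂ (proj₂ (proj₂ rotation)))
  old = proj₂ (proj₂ (proj₂ (proj₂ rotation)))
  y = lastFrom x zs

  move : ∀ j r i t → j + r + (i + t) ≡ j + (i + r + t)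
  move = solve-∀

  split : ∀ u v → trailMult U u v ≡ joins (a , y) u v + r u v + trailMult W u v
  split u v = trans (∑-↭ _ perm) (cong (_+ trailMult W u v) (old u v))

  -- Both count edges at `a` including the pending one: `ab` with all trails for `c`, `ay` with the
  -- remaining trails for `c′`.
  c c′ : Fin n → ℕ
  c  v = joins (a , b) a v + trailMult U a v
  c′ v = joins (a , y) a v + trailMult W a v

  c-split : ∀ v → joins (a , b) a v + r a v + c′ v ≡ c v
  c-split v = trans (move (joins (a , b) a v) (r a v) (joins (a , y) a v) (trailMult W a v))
    (sym (cong (joins (a , b) a v +_) (split a v)))

  c′≤c : ∀ v → c′ v ≤ c v
  c′≤c v = ≤-trans (m≤n+m (c′ v) (joins (a , b) a v + r a v)) (≤-reflexive (c-split v))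

  c′b≤0 : c′ b ≤ 0
  c′b≤0 = s≤s⁻¹ (≤-trans (+-monoˡ-≤ (c′ b) (≤-trans (≤-reflexive (sym (joins-self a b))) (m≤m+n _ _)))
    (≤-trans (≤-reflexive (c-split b)) (≤1 b)))

  hit′ : ∀ v → 1 ≤ c′ v → v ∈ map end W
  hit′ v pos with ∈-resp-↭ (↭.map⁺ end perm) (hit v (≤-trans pos (c′≤c v)))
  ... | here refl = contradiction (≤-trans pos c′b≤0) λ ()
  ... | there v∈  = v∈

  rec = extend k W (suc-injective (trans (sym (↭-length perm)) len)) simpleW a y
    (λ v → ≤-trans (c′≤c v) (≤1 v)) (n≤0⇒n≡0 (≤-trans (c′≤c a) (≤-reflexive ≡0))) hit′
  W′ = proj₁ rec
  simpleW′ = proj₁ (proj₂ rec)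
  startsW′ = proj₁ (proj₂ (proj₂ rec))
  endsW′ = proj₁ (proj₂ (proj₂ (proj₂ rec)))
  multW′ = proj₂ (proj₂ (proj₂ (proj₂ rec)))

-- Completing a partial cover of an even graph.

-- `R` holds the edges still to be added. The ends are left free here and tracked separately, since
-- they change with every added edge.
record PartialCover (H : Graph n) (R : List (Edge n)) (U : List (Trail n)) : Set where
  field
    simple : All Simple U
    starts : map start U ↭ allFin n
    covers : ∀ u v → trailMult U u v + mult R u v ≡ 𝟙 (adj H u v)

covers-++ : {H : Graph n} {R : List (Edge n)} {U : List (Trail n)} → PartialCover H R U →
  Covers (allEdges U ++ R) H
covers-++ {U = U} P u v = trans (∑-++ (allEdges U) _ _)
  (trans (cong (_+ _) (sym (trailMult≡mult U u v))) (PartialCover.covers P u v))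

-- Only `p` can fail to be an end, and it is not its own neighbour, so all its neighbours are ends
-- and `extend` applies. The deficiency passes from `p` to `q`, while the surplus stays at `a`.
addEdge : {H : Graph n} {R : List (Edge n)} {U : List (Trail n)} {a : Fin n}
  (R′ : List (Edge n)) (p q : Fin n) →
  PartialCover H R U → (∀ u v → mult R u v ≡ joins (p , q) u v + mult R′ u v) →
  p ∷ map end U ↭ a ∷ allFin n →
  ∃ λ U′ → PartialCover H R′ U′ × (q ∷ map end U′ ↭ a ∷ allFin n)
addEdge {n} {H} {R} {U} {a} R′ p q P R≡ ends =
  let U′ , simple′ , starts′ , ends′ , mult′ =
        extend (length U) U refl (PartialCover.simple P) p q ≤1 ≡0 hit
  in U′ , record
    { simple = simple′
    ; starts = ↭-trans starts′ (PartialCover.starts P)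
    ; covers = λ u v → trans (cong (_+ mult R′ u v) (mult′ u v))
        (trans (total (trailMult U u v) (joins (p , q) u v) (mult R′ u v)) (covers′ u v))
    } , ↭-trans ends′ ends
  where
  total : ∀ t j m → j + t + m ≡ t + (j + m)
  total = solve-∀

  covers′ : ∀ u v → trailMult U u v + (joins (p , q) u v + mult R′ u v) ≡ 𝟙 (adj H u v)
  covers′ u v = trans (cong (trailMult U u v +_) (sym (R≡ u v))) (PartialCover.covers P u v)

  c : Fin n → ℕ
  c v = joins (p , q) p v + trailMult U p v

  c≤ : ∀ v → c v ≤ 𝟙 (adj H p v)
  c≤ v = ≤-trans (m≤m+n (c v) (mult R′ p v))
    (≤-reflexive (trans (total (trailMult U p v) (joins (p , q) p v) (mult R′ p v)) (covers′ p v)))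

  ≤1 : ∀ v → c v ≤ 1
  ≤1 v = ≤-trans (c≤ v) (𝟙≤1 (adj H p v))

  ≡0 : c p ≡ 0
  ≡0 = n≤0⇒n≡0 (≤-trans (c≤ p) (≤-reflexive (cong 𝟙 (irrfl H p))))

  hit : ∀ v → 1 ≤ c v → v ∈ map end U
  hit v pos with ∈-resp-↭ (↭-sym ends) (there (∈-allFin v))
  ... | there v∈  = v∈
  ... | here refl = contradiction (≤-trans pos (≤-reflexive ≡0)) λ ()

-- The ends are the vertices themselves, except that a may be an end twice and b not at all.
data Ends (U : List (Trail n)) : Set where
  balanced   : map end U ↭ allFin n → Ends U
  unbalanced : ∀ {a b} → a ≢ b → b ∷ map end U ↭ a ∷ allFin n → Ends U

-- Balance is restored exactly when the deficiency has arrived at the surplus vertex.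
classify : {U : List (Trail n)} {a b : Fin n} → b ∷ map end U ↭ a ∷ allFin n → Ends U
classify {a = a} {b} p with a ≟ b
... | yes refl = balanced (drop-∷ p)
... | no  a≢b  = unbalanced a≢b p

nonzero-summand : (xs : List X) (f : X → ℕ) → ∑ xs f ≢ 0 → ∃ λ x → x ∈ xs × f x ≢ 0
nonzero-summand []       f ≢0 = contradiction refl ≢0
nonzero-summand (x ∷ xs) f ≢0 with f x in eq
... | suc _ = x , here refl , λ fx≡0 → contradiction (trans (sym eq) fx≡0) λ ()
... | zero  = let y , y∈ , fy≢0 = nonzero-summand xs f ≢0 in y , there y∈ , fy≢0

incident-edge : (R : List (Edge n)) (b : Fin n) → incidences R b ≢ 0 →
  ∃ λ c → (b , c) ∈ R ⊎ (c , b) ∈ R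
incident-edge R b ≢0 with nonzero-summand R _ ≢0
... | (x , y) , e∈ , δ≢0 with x ≟ b | y ≟ b
... | yes refl | _        = y , inj₁ e∈
... | no  _    | yes refl = x , inj₂ e∈
... | no  x≢b  | no y≢b   = contradiction (cong₂ _+_ (δ-≢ x≢b) (δ-≢ y≢b)) δ≢0

unhit-vertex : {H : Graph n} → IsEvenGraph H → {R : List (Edge n)} {U : List (Trail n)} {a b : Fin n} →
  PartialCover H R U → a ≢ b → b ∷ map end U ↭ a ∷ allFin n → incidences R b ≢ 0
unhit-vertex {n} {H} even {R} {U} {a} {b} P a≢b perm ≡0 =
  contradiction (trans (sym (cong (λ d → 𝟙 (d ≡ᵇ 1)) (even b))) odd) λ ()
  where
  open ≡-Reasoning
  noEnd : ∑ (map end U) (λ x → δ x b) ≡ 0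
  noEnd = suc-injective (begin
    1 + ∑ (map end U) (λ x → δ x b)      ≡⟨ cong (_+ ∑ (map end U) (λ x → δ x b)) (δ-refl b) ⟨
    ∑ (b ∷ map end U) (λ x → δ x b)      ≡⟨ ∑-↭ _ perm ⟩
    ∑ (a ∷ allFin n) (λ x → δ x b)       ≡⟨ cong₂ _+_ (δ-≢ a≢b) (∑-δ₁ b) ⟩
    1                                    ∎)

  oneEnd : endCount U b ≡ 1
  oneEnd = begin
    endCount U b
      ≡⟨ ∑-++ (map start U) (map end U) _ ⟩
    ∑ (map start U) (λ x → δ x b) + ∑ (map end U) (λ x → δ x b)
      ≡⟨ cong₂ _+_ (trans (∑-↭ _ (PartialCover.starts P)) (∑-δ₁ b)) noEnd ⟩
    1 ∎

  deg≡ : deg H b ≡ incidences (allEdges U) b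
  deg≡ = begin
    deg H b                                     ≡⟨ deg≡incidences H (allEdges U ++ R) (covers-++ P) b ⟩
    incidences (allEdges U ++ R) b              ≡⟨ incidences-++ (allEdges U) R b ⟩
    incidences (allEdges U) b + incidences R b  ≡⟨ cong (incidences (allEdges U) b +_) ≡0 ⟩
    incidences (allEdges U) b + 0               ≡⟨ +-identityʳ _ ⟩
    incidences (allEdges U) b                   ∎

  odd : oddBit (deg H b) ≡ 1
  odd = let k , parity = trails-incidences U b in trans (oddBit-even-sum (deg H b) (endCount U b) k
    (trans (cong (_+ endCount U b) deg≡) parity)) (cong oddBit oneEnd)

record BalancedCover (H : Graph n) : Set where
  field
    trails : List (Trail n)
    simple : All Simple trails
    starts : map start trails ↭ allFin n
    ends   : map end trails ↭ allFin n
    covers : ∀ u v → trailMult trails u v ≡ 𝟙 (adj H u v)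

complete : {H : Graph n} → IsEvenGraph H → ∀ k (R : List (Edge n)) {U : List (Trail n)} →
  length R ≡ k → PartialCover H R U → Ends U → BalancedCover H
complete even zero [] {U} len P (balanced perm) = record
  { trails = U
  ; simple = PartialCover.simple P
  ; starts = PartialCover.starts P
  ; ends   = perm
  ; covers = λ u v → trans (sym (+-identityʳ _)) (PartialCover.covers P u v)
  }
complete even (suc k) ((p , q) ∷ R) len P (balanced perm) =
  let _ , P′ , perm′ = addEdge R p q P (λ _ _ → refl) (prep p perm)
  in complete even k R (suc-injective len) P′ (classify perm′)
complete even zero [] len P (unbalanced a≢b perm) =
  contradiction refl (unhit-vertex even P a≢b perm)
complete even (suc k) R len P (unbalanced {b = b} a≢b perm)
  with incident-edge R b (unhit-vertex even P a≢b perm)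
... | c , inj₁ e∈ =
  let R′ , R↭ = ∈⇒↭∷ e∈
      _ , P′ , perm′ = addEdge R′ b c P (λ u v → ∑-↭ _ R↭) perm
  in complete even k R′ (suc-injective (trans (sym (↭-length R↭)) len)) P′ (classify perm′)
... | c , inj₂ e∈ =
  let R′ , R↭ = ∈⇒↭∷ e∈
      _ , P′ , perm′ = addEdge R′ b c P
        (λ u v → trans (∑-↭ _ R↭) (cong (_+ mult R′ u v) (joins-flip c b u v))) perm
  in complete even k R′ (suc-injective (trans (sym (↭-length R↭)) len)) P′ (classify perm′)

-- The edge list of a graph and its balanced cover.

module _ (H : Graph n) where

  -- Orienting each edge from the smaller to the larger vertex lists it once instead of twice.
  isEdge : Fin n → Fin n → Bool
  isEdge x y = does (x <? y) ∧ adj H x y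

  edgeList : List (Edge n)
  edgeList = concatMap (λ x → concatMap (λ y → if isEdge x y then (x , y) ∷ [] else []) (allFin n)) (allFin n)

  isEdge-sum : ∀ u v → 𝟙 (isEdge u v) + 𝟙 (isEdge v u) ≡ 𝟙 (adj H u v)
  isEdge-sum u v with <-cmp u v
  ... | tri< u<v _ v≮u rewrite dec-true (u <? v) u<v | dec-false (v <? u) v≮u = +-identityʳ _
  ... | tri> u≮v _ v<u rewrite dec-false (u <? v) u≮v | dec-true (v <? u) v<u = cong 𝟙 (Graph.sym H v u)
  ... | tri≈ u≮u refl _ rewrite dec-false (u <? u) u≮u | irrfl H u = refl

  mult-edgeList : ∀ u v → mult edgeList u v ≡ 𝟙 (adj H u v)
  mult-edgeList u v = begin
    mult edgeList u v
      ≡⟨ trans (∑-concatMap _ (allFin n) _) (∑-cong (allFin n) (λ x →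
           trans (∑-concatMap _ (allFin n) _) (∑-cong (allFin n) (λ y → at x y)))) ⟩
    ∑ (allFin n) (λ x → ∑ (allFin n) (λ y →
      δ x u * (δ y v * 𝟙 (isEdge x y)) + δ x v * (δ y u * 𝟙 (isEdge x y))))
      ≡⟨ ∑-cong (allFin n) (λ x → trans (∑-+ (allFin n) _ _) (cong₂ _+_ (inner x u v) (inner x v u))) ⟩
    ∑ (allFin n) (λ x → δ x u * 𝟙 (isEdge x v) + δ x v * 𝟙 (isEdge x u))
      ≡⟨ ∑-+ (allFin n) _ _ ⟩
    ∑ (allFin n) (λ x → δ x u * 𝟙 (isEdge x v)) + ∑ (allFin n) (λ x → δ x v * 𝟙 (isEdge x u))
      ≡⟨ cong₂ _+_ (∑-δ u _) (∑-δ v _) ⟩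
    𝟙 (isEdge u v) + 𝟙 (isEdge v u)
      ≡⟨ isEdge-sum u v ⟩
    𝟙 (adj H u v) ∎
    where
    open ≡-Reasoning
    inner : ∀ x u v → ∑ (allFin n) (λ y → δ x u * (δ y v * 𝟙 (isEdge x y))) ≡ δ x u * 𝟙 (isEdge x v)
    inner x u v = trans (∑-*ˡ (allFin n) (δ x u) _) (cong (δ x u *_) (∑-δ v _))
    lemma : ∀ a b c d → a * b + d * c + 0 ≡ a * (b * 1) + c * (d * 1)
    lemma = solve-∀
    lemma₀ : ∀ a b c d → 0 ≡ a * (b * 0) + c * (d * 0)
    lemma₀ = solve-∀
    at : ∀ x y → mult (if isEdge x y then (x , y) ∷ [] else []) u v ≡
         δ x u * (δ y v * 𝟙 (isEdge x y)) + δ x v * (δ y u * 𝟙 (isEdge x y))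
    at x y with isEdge x y in eq
    ... | false = lemma₀ (δ x u) (δ y v) (δ x v) (δ y u)
    ... | true  = trans (cong (_+ 0) (joins-δ x≢y u v)) (lemma (δ x u) (δ y v) (δ x v) (δ y u))
      where
      x≢y : x ≢ y
      x≢y refl with () ← trans (sym (irrfl H x)) (∧-conicalʳ (does (x <? x)) _ eq)

  balancedCover : IsEvenGraph H → BalancedCover H
  balancedCover even = complete even (length edgeList) edgeList {U = trivial} refl
    record
    { simple = All.map⁺ (All.tabulate (λ _ → [] ∷ []))
    ; starts = ↭-reflexive (trans (sym (map-∘ (allFin n))) (map-id (allFin n)))
    ; covers = λ u v → cong₂ _+_ (trans (∑-map (_, []) (allFin n) _) (∑-zero (allFin n))) (mult-edgeList u v)
    }
    (balanced (↭-reflexive (trans (sym (map-∘ (allFin n))) (map-id (allFin n)))))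
    where
    trivial : List (Trail n)
    trivial = map (_, []) (allFin n)

-- The path number from a cover with distinct terminals.

-- `IsPathDecomposition` prescribes uses on edges only. The zero that `Covers` wants on non-edges
-- comes from the fact that paths step along edges.
joins-nonadjacent : (G : Graph n) {x y u v : Fin n} → adj G x y ≡ true → adj G u v ≡ false →
  joins (x , y) u v ≡ 0
joins-nonadjacent G {x} {y} {u} {v} xy uv = cong 𝟙 (cong₂ _∨_
  (distinct u v λ { refl refl → contradiction (trans (sym xy) uv) λ () })
  (distinct v u λ { refl refl → contradiction (trans (sym xy) (trans (Graph.sym G x y) uv)) λ () }))
  where
  distinct : ∀ u v → (x ≡ u → y ≡ v → ⊥) → (x =ᶠ u) ∧ (y =ᶠ v) ≡ false
  distinct u v ≢ with x ≟ u
  ... | no  x≢u  rewrite =ᶠ-≢ x≢u = refl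
  ... | yes refl rewrite =ᶠ-refl x = =ᶠ-≢ (≢ refl)

-- Distinct terminals yield two odd vertices per trail, so the number of trails attains the lower
-- bound that parity imposes on every decomposition.
pathNumber : (G : Graph n) (U : List (Trail n)) → All Simple U → All (λ p → 2 ≤ length (verts p)) U →
  Covers (allEdges U) G → Unique (terminals U) → PathNumberIs G (nOdd G / 2)
pathNumber {n} G U simple long cov uq = (map verts U , (paths , uses) , size) , minimal
  where
  isPath : ∀ {p} → p ∈ U → IsPath G (verts p)
  isPath p∈ = All.lookup simple p∈
    , All.tabulate (λ e∈ → covers⇒adj G (allEdges U) cov (∈-concatMap⁺ edges (lose p∈ e∈)))
    , All.lookup long p∈
  paths : All (IsPath G) (map verts U)
  paths = All.map⁺ (All.tabulate isPath)
  uses : ∀ u v → adj G u v ≡ true → edgeUses (map verts U) u v ≡ 1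
  uses u v uv = trans (edgeUses≡mult U u v) (trans (cov u v) (cong 𝟙 uv))
  size : length (map verts U) ≡ nOdd G / 2
  size = trans (length-map verts U)
    (sym (trans (cong (_/ 2) (nOdd≡ G U cov uq)) (m*n/n≡m (length U) 2)))
  minimal : ∀ ps → IsPathDecomposition G ps → nOdd G / 2 ≤ length ps
  minimal ps (paths , uses) with W , refl ← trailsOf {G = G} paths = begin
    nOdd G / 2            ≤⟨ /-monoˡ-≤ 2 (nOdd≤ G W covW) ⟩
    length W * 2 / 2      ≡⟨ m*n/n≡m (length W) 2 ⟩
    length W              ≡⟨ length-map verts W ⟨
    length (map verts W)  ∎
    where
    open ≤-Reasoning
    edge-adj : ∀ {x y} → (x , y) ∈ allEdges W → adj G x y ≡ true
    edge-adj e∈ with _ , p∈ , e∈p ← find (∈-concatMap⁻ edges {xs = W} e∈) =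
      All.lookup (proj₁ (proj₂ (All.lookup (All.map⁻ paths) p∈))) e∈p
    covW : Covers (allEdges W) G
    covW u v with adj G u v in uv
    ... | true  = trans (sym (edgeUses≡mult W u v)) (uses u v uv)
    ... | false = trans (∑-cong-∈ (allEdges W) unjoined) (∑-zero (allEdges W))
      where
      unjoined : ∀ {e} → e ∈ allEdges W → joins e u v ≡ 0
      unjoined e∈ = joins-nonadjacent G (edge-adj e∈) uv

-- Images of trails under injections, and gluing.

joins-sym : (e : Edge n) (u v : Fin n) → joins e u v ≡ joins e v u
joins-sym (x , y) u v = cong 𝟙 (∨-comm ((x =ᶠ u) ∧ (y =ᶠ v)) _)

joins-map : ∀ {m} {f : Fin m → Fin n} → (∀ {x y} → f x ≡ f y → x ≡ y) →
  ∀ x y u v → joins (f x , f y) (f u) (f v) ≡ joins (x , y) u v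
joins-map inj x y u v
  rewrite =ᶠ-injective inj x u | =ᶠ-injective inj y v | =ᶠ-injective inj x v | =ᶠ-injective inj y u = refl

joins-∉ : {x y u : Fin n} (v : Fin n) → x ≢ u → y ≢ u → joins (x , y) u v ≡ 0
joins-∉ {x = x} v x≢u y≢u rewrite =ᶠ-≢ x≢u | =ᶠ-≢ y≢u = cong 𝟙 (∧-zeroʳ (x =ᶠ v))

trailMult-sym : (U : List (Trail n)) (u v : Fin n) → trailMult U u v ≡ trailMult U v u
trailMult-sym U u v = ∑-cong U (λ p → ∑-cong (edges p) (λ e → joins-sym e u v))

mapTrail : ∀ {m} → (Fin m → Fin n) → Trail m → Trail n
mapTrail f (x , xs) = f x , map f xs

lastFrom-map : ∀ {m} (f : Fin m → Fin n) x xs → lastFrom (f x) (map f xs) ≡ f (lastFrom x xs)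
lastFrom-map f x []       = refl
lastFrom-map f x (y ∷ ys) = lastFrom-map f y ys

mult-map : ∀ {m} (f : Fin m → Fin n) x xs u v →
  mult (steps (map f (x ∷ xs))) u v ≡ ∑ (steps (x ∷ xs)) (λ (a , b) → joins (f a , f b) u v)
mult-map f x []       u v = refl
mult-map f x (y ∷ ys) u v = cong (joins (f x , f y) u v +_) (mult-map f y ys u v)

trailMult-map : ∀ {m} (f : Fin m → Fin n) U u v →
  trailMult (map (mapTrail f) U) u v ≡ ∑ U (λ p → ∑ (edges p) (λ (a , b) → joins (f a , f b) u v))
trailMult-map f U u v = trans (∑-map (mapTrail f) U _) (∑-cong U (λ (x , xs) → mult-map f x xs u v))

trailMult-map-injective : ∀ {m} {f : Fin m → Fin n} → (∀ {x y} → f x ≡ f y → x ≡ y) →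
  ∀ U u v → trailMult (map (mapTrail f) U) (f u) (f v) ≡ trailMult U u v
trailMult-map-injective {f = f} inj U u v = trans (trailMult-map f U (f u) (f v))
  (∑-cong U (λ p → ∑-cong (edges p) (λ (a , b) → joins-map inj a b u v)))

trailMult-map-∉ : ∀ {m} (f : Fin m → Fin n) U {u} v → (∀ x → f x ≢ u) →
  trailMult (map (mapTrail f) U) u v ≡ 0
trailMult-map-∉ f U {u} v f≢u = trans (trailMult-map f U u v)
  (trans (∑-cong U (λ p → trans (∑-cong (edges p) (λ (a , b) → joins-∉ v (f≢u a) (f≢u b))) (∑-zero (edges p))))
         (∑-zero U))

module Glue {m k : ℕ} (f : Fin m → Fin n) (g : Fin k → Fin n) where

  -- The step from `f (end p)` to `g (start q)` is a new edge, accounted for by its own term in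
  -- `mult-glue`.
  glue : Trail m → Trail k → Trail n
  glue (x , xs) (y , ys) = f x , map f xs ++ g y ∷ map g ys

  end-glue : ∀ p q → end (glue p q) ≡ g (end q)
  end-glue (x , xs) (y , ys) = trans (lastFrom-++ (f x) (map f xs) (g y) (map g ys)) (lastFrom-map g y ys)

  long-glue : ∀ p q → 2 ≤ length (verts (glue p q))
  long-glue (x , xs) (y , ys) = s≤s (≤-trans (s≤s z≤n) (≤-trans (m≤n+m _ (length (map f xs)))
    (≤-reflexive (sym (length-++ (map f xs))))))

  mult-glue : ∀ p q u v → mult (edges (glue p q)) u v ≡
    mult (edges (mapTrail f p)) u v + joins (f (end p) , g (start q)) u v + mult (edges (mapTrail g q)) u v
  mult-glue (x , xs) (y , ys) u v = trans (mult-++ (f x) (map f xs) (g y) (map g ys) u v)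
    (cong (λ z → mult (steps (map f (x ∷ xs))) u v + joins (z , g y) u v + mult (steps (map g (y ∷ ys))) u v)
          (lastFrom-map f x xs))

  glueAll : List (Trail m) → List (Trail k) → List (Trail n)
  glueAll = zipWith glue

  module _ (link : Fin m → Fin k) where

    -- The equation forces `P` and `Q` to have equal length, so `zipWith` discards nothing.
    starts-glue : ∀ {P Q} → map (link ∘ end) P ≡ map start Q → map start (glueAll P Q) ≡ map f (map start P)
    starts-glue {[]}    {[]}    eq = refl
    starts-glue {p ∷ P} {q ∷ Q} eq = cong (_ ∷_) (starts-glue (∷-injectiveʳ eq))

    ends-glue : ∀ {P Q} → map (link ∘ end) P ≡ map start Q → map end (glueAll P Q) ≡ map g (map end Q)
    ends-glue {[]}    {[]}    eq = refl
    ends-glue {p ∷ P} {q ∷ Q} eq = cong₂ _∷_ (end-glue p q) (ends-glue (∷-injectiveʳ eq))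

    -- The connecting edges are indexed by the ends of `P` alone, so their sum depends only on these
    -- ends as a multiset.
    trailMult-glue : ∀ {P Q} → map (link ∘ end) P ≡ map start Q → ∀ u v →
      trailMult (glueAll P Q) u v ≡
      trailMult (map (mapTrail f) P) u v + ∑ (map end P) (λ x → joins (f x , g (link x)) u v)
        + trailMult (map (mapTrail g) Q) u v
    trailMult-glue {[]}    {[]}    eq u v = refl
    trailMult-glue {p ∷ P} {q ∷ Q} eq u v = trans
      (cong₂ _+_ (trans (mult-glue p q u v)
                   (cong (λ z → mult (edges (mapTrail f p)) u v + joins (f (end p) , g z) u v + _) (sym (∷-injectiveˡ eq))))
                 (trailMult-glue (∷-injectiveʳ eq) u v))
      (regroup (mult (edges (mapTrail f p)) u v) (joins (f (end p) , g (link (end p))) u v)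
        (mult (edges (mapTrail g q)) u v) (trailMult (map (mapTrail f) P) u v)
        (∑ (map end P) (λ x → joins (f x , g (link x)) u v)) _)
      where
      regroup : ∀ a b c d e f → a + b + c + (d + e + f) ≡ a + d + (b + e) + (c + f)
      regroup = solve-∀

  module _ (f-inj : ∀ {x y} → f x ≡ f y → x ≡ y) (g-inj : ∀ {x y} → g x ≡ g y → x ≡ y)
           (disjoint : ∀ x y → f x ≢ g y) where

    simple-glue : ∀ {p q} → Simple p → Simple q → Simple (glue p q)
    simple-glue {x , xs} {y , ys} sp sq = Unique.++⁺ (Unique.map⁺ f-inj sp) (Unique.map⁺ g-inj sq)
      λ (∈f , ∈g) → let a , _ , eq₁ = ∈-map⁻ f ∈f ; b , _ , eq₂ = ∈-map⁻ g {xs = y ∷ ys} ∈g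
                    in disjoint a b (trans (sym eq₁) eq₂)

-- Layers of the product with a path.

↑ˡ≢↑ʳ : ∀ {m n} (x : Fin m) (y : Fin n) → x ↑ˡ n ≢ m ↑ʳ y
↑ˡ≢↑ʳ {m} {n} x y eq with () ← trans (sym (splitAt-↑ˡ m x n)) (trans (cong (splitAt m) eq) (splitAt-↑ʳ m n y))

-- A view of an index as an explicit injection. Since `suc k * n` unfolds to `n + k * n`, it
-- separates the first layer from the others.
data Side (m n : ℕ) : Fin (m + n) → Set where
  left  : (x : Fin m) → Side m n (x ↑ˡ n)
  right : (y : Fin n) → Side m n (m ↑ʳ y)

side : ∀ m n (u : Fin (m + n)) → Side m n u
side m n u with splitAt m u | join-splitAt m n u
... | inj₁ x | refl = left x
... | inj₂ y | refl = right y

module _ (H : Graph n) where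

  adj-left : ∀ k a b → adj (pathGraph (suc k) □ H) (a ↑ˡ (k * n)) (b ↑ˡ (k * n)) ≡ adj H a b
  adj-left k a b rewrite splitAt-↑ˡ n a (k * n) | splitAt-↑ˡ n b (k * n) = refl

  -- Raising both layer indices by one changes neither their adjacency in the path nor their
  -- equality.
  adj-right : ∀ k x y → adj (pathGraph (suc k) □ H) (n ↑ʳ x) (n ↑ʳ y) ≡ adj (pathGraph k □ H) x y
  adj-right k x y rewrite splitAt-↑ʳ n (k * n) x | splitAt-↑ʳ n (k * n) y = refl

  -- The first layer meets only the next one, and there only above the same vertex of `H`; layers
  -- further up differ from it by at least two.
  adj-cross : ∀ k a (y : Fin (suc k * n)) →
    adj (pathGraph (suc (suc k)) □ H) (a ↑ˡ (suc k * n)) (n ↑ʳ y) ≡ ((a ↑ˡ (k * n)) =ᶠ y)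
  adj-cross k a y with side n (k * n) y
  ... | left b
    rewrite splitAt-↑ˡ n a (suc k * n) | splitAt-↑ʳ n (suc k * n) (b ↑ˡ (k * n)) | splitAt-↑ˡ n b (k * n)
    = trans (∨-identityʳ _) (sym (=ᶠ-injective (λ {x} {y} → ↑ˡ-injective (k * n) x y) a b))
  ... | right z
    rewrite splitAt-↑ˡ n a (suc k * n) | splitAt-↑ʳ n (suc k * n) (n ↑ʳ z) | splitAt-↑ʳ n (k * n) z
    = sym (=ᶠ-≢ (↑ˡ≢↑ʳ a z))

  -- New layers are put in front, so the starts must be known exactly in order to be joined to them;
  -- of the ends only distinctness has to survive.
  record LayeredCover (k : ℕ) : Set where
    field
      trails : List (Trail (suc k * n))
      simple : All Simple trails
      starts : map start trails ↭ map (_↑ˡ (k * n)) (allFin n)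
      ends   : Unique (map end trails)
      covers : ∀ u v → trailMult trails u v ≡ 𝟙 (adj (pathGraph (suc k) □ H) u v)

  module Stack (B : BalancedCover H) (k : ℕ) (C : LayeredCover k) where
    private
      module Base = BalancedCover B
      module Above = LayeredCover C

    first : Fin n → Fin (suc (suc k) * n)
    first = _↑ˡ (suc k * n)

    later : Fin (suc k * n) → Fin (suc (suc k) * n)
    later = n ↑ʳ_

    link : Fin n → Fin (suc k * n)
    link = _↑ˡ (k * n)

    first-inj : ∀ {x y} → first x ≡ first y → x ≡ y
    first-inj {x} {y} = ↑ˡ-injective (suc k * n) x y

    later-inj : ∀ {x y} → later x ≡ later y → x ≡ y
    later-inj {x} {y} = ↑ʳ-injective n x y

    first≢later : ∀ x y → first x ≢ later y
    first≢later = ↑ˡ≢↑ʳ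

    open Glue first later

    linked : map (link ∘ end) Base.trails ↭ map start Above.trails
    linked = ↭-trans (↭-reflexive (map-∘ Base.trails))
      (↭-trans (↭.map⁺ link Base.ends) (↭-sym Above.starts))

    -- `glueAll` pairs trails by position, so the trails above are reordered until their starts
    -- match the linked ends literally.
    upper : List (Trail (suc k * n))
    upper = proj₁ (↭.↭-map-inv start (↭-sym linked))

    linked≡ : map (link ∘ end) Base.trails ≡ map start upper
    linked≡ = proj₁ (proj₂ (↭.↭-map-inv start (↭-sym linked)))

    upper↭ : Above.trails ↭ upper
    upper↭ = proj₂ (proj₂ (↭.↭-map-inv start (↭-sym linked)))

    trails : List (Trail (suc (suc k) * n))
    trails = glueAll Base.trails upper

    simple : All Simple trails
    simple = All-zipWith (simple-glue first-inj later-inj first≢later) Base.simple (All-resp-↭ upper↭ Above.simple)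
      where
      All-zipWith : ∀ {P Q} → (∀ {p q} → Simple p → Simple q → Simple (glue p q)) →
        All Simple P → All Simple Q → All Simple (glueAll P Q)
      All-zipWith f []       _        = []
      All-zipWith f (_ ∷ _)  []       = []
      All-zipWith f (p ∷ ps) (q ∷ qs) = f p q ∷ All-zipWith f ps qs

    long : All (λ p → 2 ≤ length (verts p)) trails
    long = go Base.trails upper
      where
      go : ∀ P Q → All (λ p → 2 ≤ length (verts p)) (glueAll P Q)
      go []      _       = []
      go (_ ∷ _) []      = []
      go (p ∷ P) (q ∷ Q) = long-glue p q ∷ go P Q

    starts : map start trails ↭ map first (allFin n)
    starts = ↭-trans (↭-reflexive (starts-glue link linked≡)) (↭.map⁺ first Base.starts)

    ends≡ : map end trails ≡ map later (map end upper)
    ends≡ = ends-glue link linked≡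

    ends : Unique (map end trails)
    ends = subst Unique (sym ends≡)
      (Unique.map⁺ later-inj (Unique-resp-↭ (↭.map⁺ end upper↭) Above.ends))

    bridges : Fin (suc (suc k) * n) → Fin (suc (suc k) * n) → ℕ
    bridges u v = ∑ (allFin n) (λ x → joins (first x , later (link x)) u v)

    -- Edges fall into three kinds: inside the first layer, between the first two layers, and beyond
    -- the first layer. The reordering is undone so that the covering property of `Above.trails`
    -- applies directly.
    trailMult≡ : ∀ u v → trailMult trails u v ≡
      trailMult (map (mapTrail first) Base.trails) u v + bridges u v + trailMult (map (mapTrail later) Above.trails) u v
    trailMult≡ u v = trans (trailMult-glue link linked≡ u v)
      (cong₂ _+_ (cong (trailMult (map (mapTrail first) Base.trails) u v +_) (∑-↭ _ Base.ends))
                 (∑-↭ _ (↭.map⁺ (mapTrail later) (↭-sym upper↭))))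

    bridge-δ : ∀ x u v → joins (first x , later (link x)) u v ≡
      δ (first x) u * δ (later (link x)) v + δ (later (link x)) u * δ (first x) v
    bridge-δ x = joins-δ (first≢later x (link x))

    bridges-first : ∀ a b → bridges (first a) (first b) ≡ 0
    bridges-first a b = trans (∑-cong (allFin n) at) (∑-zero (allFin n))
      where
      at : ∀ x → joins (first x , later (link x)) (first a) (first b) ≡ 0
      at x = trans (bridge-δ x (first a) (first b)) (cong₂ _+_
        (trans (cong (δ (first x) (first a) *_) (δ-≢ (first≢later b (link x) ∘ sym))) (*-zeroʳ (δ (first x) (first a))))
        (cong (_* δ (first x) (first b)) (δ-≢ (first≢later a (link x) ∘ sym))))

    bridges-later : ∀ y z → bridges (later y) (later z) ≡ 0
    bridges-later y z = trans (∑-cong (allFin n) at) (∑-zero (allFin n))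
      where
      at : ∀ x → joins (first x , later (link x)) (later y) (later z) ≡ 0
      at x = trans (bridge-δ x (later y) (later z)) (cong₂ _+_
        (cong (_* δ (later (link x)) (later z)) (δ-≢ (first≢later x y)))
        (trans (cong (δ (later (link x)) (later y) *_) (δ-≢ (first≢later x z))) (*-zeroʳ (δ (later (link x)) (later y)))))

    bridges-cross : ∀ a y → bridges (first a) (later y) ≡ δ (link a) y
    bridges-cross a y = trans (∑-cong (allFin n) at) (∑-δ a (λ x → δ (link x) y))
      where
      at : ∀ x → joins (first x , later (link x)) (first a) (later y) ≡ δ x a * δ (link x) y
      at x = trans (bridge-δ x (first a) (later y)) (trans (cong₂ _+_
        (cong₂ _*_ (cong 𝟙 (=ᶠ-injective first-inj x a)) (cong 𝟙 (=ᶠ-injective later-inj (link x) y)))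
        (cong (_* δ (first x) (later y)) (δ-≢ (first≢later a (link x) ∘ sym)))) (+-identityʳ _))

    covers-cross : ∀ a y → trailMult trails (first a) (later y) ≡
      𝟙 (adj (pathGraph (suc (suc k)) □ H) (first a) (later y))
    covers-cross a y = trans (trailMult≡ (first a) (later y)) (trans (cong₂ _+_
      (cong₂ _+_
        (trans (trailMult-sym (map (mapTrail first) Base.trails) (first a) (later y))
               (trailMult-map-∉ first Base.trails (first a) (λ x → first≢later x y)))
        (bridges-cross a y))
      (trailMult-map-∉ later Above.trails (later y) (λ z → first≢later a z ∘ sym)))
      (trans (+-identityʳ _) (cong 𝟙 (sym (adj-cross k a y)))))

    covers : ∀ u v → trailMult trails u v ≡ 𝟙 (adj (pathGraph (suc (suc k)) □ H) u v)
    covers u v with side n (suc k * n) u | side n (suc k * n) v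
    ... | left a | left b = trans (trailMult≡ (first a) (first b)) (trans (cong₂ _+_
      (cong₂ _+_ (trailMult-map-injective first-inj Base.trails a b) (bridges-first a b))
      (trailMult-map-∉ later Above.trails (first b) (λ z → first≢later a z ∘ sym)))
      (trans (+-identityʳ _) (trans (+-identityʳ _)
        (trans (Base.covers a b) (cong 𝟙 (sym (adj-left (suc k) a b)))))))
    ... | right y | right z = trans (trailMult≡ (later y) (later z)) (trans (cong₂ _+_
      (cong₂ _+_ (trailMult-map-∉ first Base.trails (later z) (λ x → first≢later x y)) (bridges-later y z))
      (trailMult-map-injective later-inj Above.trails y z))
      (trans (Above.covers y z) (cong 𝟙 (sym (adj-right (suc k) y z)))))
    ... | left a  | right y = covers-cross a y
    ... | right y | left a  = trans (trailMult-sym trails (later y) (first a))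
      (trans (covers-cross a y)
             (cong 𝟙 (Graph.sym (pathGraph (suc (suc k)) □ H) (first a) (later y))))

    layered : LayeredCover (suc k)
    layered = record { trails = trails ; simple = simple ; starts = starts ; ends = ends ; covers = covers }

    -- Starts lie in the first layer and ends in later ones. With a single layer every vertex would
    -- be both a start and an end.
    terminals-unique : Unique (terminals trails)
    terminals-unique = Unique.++⁺
      (Unique-resp-↭ (↭-sym starts) (Unique.map⁺ first-inj (allFin⁺ n))) ends apart
      where
      apart : ∀ {v} → v ∈ map start trails × v ∈ map end trails → ⊥
      apart (∈s , ∈e)
        with x , _ , eq₁ ← ∈-map⁻ first (∈-resp-↭ starts ∈s)
        with y , _ , eq₂ ← ∈-map⁻ later (subst (_ ∈_) ends≡ ∈e) = first≢later x y (trans (sym eq₁) eq₂)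

    pathNumber-□ : PathNumberIs (pathGraph (suc (suc k)) □ H) (nOdd (pathGraph (suc (suc k)) □ H) / 2)
    pathNumber-□ = pathNumber (pathGraph (suc (suc k)) □ H) trails simple long
      (λ u v → trans (sym (trailMult≡mult trails u v)) (covers u v)) terminals-unique

  layeredCover : BalancedCover H → ∀ k → LayeredCover k
  layeredCover B zero = record
    { trails = map (mapTrail layer) Base.trails
    ; simple = All.map⁺ (All.map (Unique.map⁺ layer-inj) Base.simple)
    ; starts = ↭-trans (↭-reflexive (trans (sym (map-∘ Base.trails)) (map-∘ Base.trails))) (↭.map⁺ layer Base.starts)
    ; ends   = subst Unique
        (trans (sym (map-∘ Base.trails)) (trans
          (map-cong (λ (x , xs) → sym (lastFrom-map layer x xs)) Base.trails) (map-∘ Base.trails)))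
                 (Unique.map⁺ layer-inj (Unique-resp-↭ (↭-sym Base.ends) (allFin⁺ n)))
    ; covers = covers
    }
    where
    module Base = BalancedCover B
    -- `1 * n` unfolds to `n + 0`, which is not `n` by computation, hence this embedding.
    layer : Fin n → Fin (1 * n)
    layer = _↑ˡ 0
    layer-inj : ∀ {x y} → layer x ≡ layer y → x ≡ y
    layer-inj {x} {y} = ↑ˡ-injective 0 x y
    covers : ∀ u v → trailMult (map (mapTrail layer) Base.trails) u v ≡ 𝟙 (adj (pathGraph 1 □ H) u v)
    covers u v with side n 0 u | side n 0 v
    ... | left a | left b = trans (trailMult-map-injective layer-inj Base.trails a b)
      (trans (Base.covers a b) (cong 𝟙 (sym (adj-left 0 a b))))
    ... | left _ | right ()
    ... | right () | _
  layeredCover B (suc k) = Stack.layered B k (layeredCover B k)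

theorem5p3 : (n : ℕ) (H : Graph n) → IsEvenGraph H →
    (m : ℕ) → 2 ≤ m →
    PathNumberIs (pathGraph m □ H) (nOdd (pathGraph m □ H) / 2)
theorem5p3 n H even (suc (suc k)) (s≤s (s≤s z≤n)) =
  -- The cover passed on has `k + 1` layers. `Stack` adds the last one and thereby supplies distinct
  -- terminals and trails with at least two vertices.
  let B = balancedCover H even in Stack.pathNumber-□ H B k (layeredCover H B k)
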